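{- For every positive integer $n$, Statement $\mathrm{P}(n)$ implies Statement $\mathrm{A}(n)$, where: $\mathrm{A}(n)$: for every separable polynomial $f(x)\in\mathbf{Z}[x]$ of degree $n$, every good prime $p$ for $f(x)$, and every integer $m$ coprime to $p$, there exist infinitely many elements $d\in\mathcal{S}(f)$ such that $d\equiv m\pmod p$. $\mathrm{P}(n)$: for every separable polynomial $h(x)\in\mathbf{Z}[x]$ of degree $n$ whose leading coefficient is a square, every good prime $p$ for $h(x)$, and every integer $m$ coprime to $p$, there exist infinitely many primes $q\in\mathcal{S}(h)$ such that $q\equiv m\pmod p$.
   Context: Squarefree integers may be negative and are nonzero. For a nonzero rational number $r$, its squarefree part $S(r)$ is the unique squarefree integer $d$ such that $r/d$ is a square in $\mathbf{Q}$. For a separable nonconstant $f(x)\in\mathbf{Z}[x]$, $\mathcal{S}(f)=\{S(f(r)) : r\in\mathbf{Q},\ f(r)\neq 0\}$. An odd prime $p$ is good for $f(x)$ if the reduced polynomial $\bar f(x)\in\mathbf{F}_p[x]$ has the same degree as $f(x)$ and has nonzero discriminant. Primes are positive. -}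

module Defs where

open import Algebra.Bundles using (CommutativeRing; Semiring)
import Algebra.Definitions.RawMonoid as RawMonoidDefs
import Algebra.Definitions.RawSemiring as RawSemiringDefs
open import Data.Bool.Base using (if_then_else_)
open import Data.Fin.Base using (Fin; zero; suc; toℕ; opposite; punchIn; splitAt)
import Data.Integer.Base as ℤ
open ℤ using (ℤ; +_)
import Data.Integer.Coprimality as ℤ
import Data.Integer.Divisibility.Signed as ℤ
import Data.Integer.Properties as ℤ
open import Data.Integer.Tactic.RingSolver using (solve-∀)
open import Data.List.Base using (List; []; _∷_; _++_; map; replicate)
open import Data.List.Membership.Propositional using (_∉_)
open import Data.Nat.Base as ℕ using (ℕ; zero; suc; pred; _<_; _≡ᵇ_; ⌊_/2⌋)
open import Data.Nat.Primality using (Prime)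
open import Data.Product.Base using (_×_; _,_; ∃; ∃₂)
import Data.Rational.Base as ℚ
open ℚ using (ℚ; 0ℚ)
open import Data.Rational.Literals using (fromℤ)
import Data.Rational.Properties as ℚ
open import Data.Sum.Base using ([_,_]′)
open import Level using (Level; 0ℓ)
open import Relation.Binary.PropositionalEquality.Core using (_≡_; _≢_; refl; sym; subst)
open import Relation.Nullary.Negation.Core using (¬_)

module Polynomials {c ℓ : Level} (R : CommutativeRing c ℓ) where
  open CommutativeRing R using (Carrier; _≈_; _+_; _*_; -_; 0#; 1#; +-rawMonoid; semiring)
  open RawMonoidDefs +-rawMonoid using (sum) renaming (_×_ to _·_)
  open RawSemiringDefs (Semiring.rawSemiring semiring) using (_^_)

  -- Coefficients, constant term first. Trailing zeros are allowed, so
  -- equality of polynomials is _≈ₚ_ and not equality of lists.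
  Poly : Set c
  Poly = List Carrier

  coeff : Poly → ℕ → Carrier
  coeff []       _       = 0#
  coeff (a ∷ _)  zero    = a
  coeff (_ ∷ as) (suc k) = coeff as k

  infix 4 _≈ₚ_
  _≈ₚ_ : Poly → Poly → Set ℓ
  f ≈ₚ g = ∀ k → coeff f k ≈ coeff g k

  HasDegree : Poly → ℕ → Set ℓ
  HasDegree f n = ¬ (coeff f n ≈ 0#) × (∀ k → n < k → coeff f k ≈ 0#)

  eval : Poly → Carrier → Carrier
  eval []       x = 0#
  eval (a ∷ as) x = a + x * eval as x

  infixl 6 _+ₚ_
  infixl 7 _*ₚ_

  _+ₚ_ : Poly → Poly → Poly
  []       +ₚ g        = g
  (a ∷ as) +ₚ []       = a ∷ as
  (a ∷ as) +ₚ (b ∷ bs) = (a + b) ∷ (as +ₚ bs)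

  _*ₚ_ : Poly → Poly → Poly
  []       *ₚ g = []
  (a ∷ as) *ₚ g = map (a *_) g +ₚ (0# ∷ (as *ₚ g))

  1ₚ : Poly
  1ₚ = 1# ∷ []

  -- Multiplication by X^k.
  shift : ℕ → Poly → Poly
  shift k g = replicate k 0# ++ g

  deriv : Poly → Poly
  deriv []       = []
  deriv (_ ∷ as) = go 1 as
    where
    go : ℕ → Poly → Poly
    go k []       = []
    go k (b ∷ bs) = (k · b) ∷ go (suc k) bs

  -- Over a field: f and f′ are coprime.
  Separable : Poly → Set _
  Separable f = ∃₂ λ u v → u *ₚ f +ₚ v *ₚ deriv f ≈ₚ 1ₚ

  Matrix : ℕ → Set c
  Matrix n = Fin n → Fin n → Carrier

  -- Laplace expansion along the first column.
  det : ∀ n → Matrix n → Carrier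
  det zero    M = 1#
  det (suc n) M =
    sum λ i → (- 1#) ^ toℕ i * (M i zero * det n λ j k → M (punchIn i j) (suc k))

  -- The Sylvester matrix of f and f′, for f of formal degree n: the rows are
  -- X^(n-2) f , … , f , X^(n-1) f′ , … , f′, and the columns hold the
  -- coefficients of X^(2n-2) , … , X , 1.
  sylvester : ∀ n → Poly → Matrix (pred n ℕ.+ n)
  sylvester n f i j =
    [ (λ k → coeff (shift (toℕ (opposite k)) f) (toℕ (opposite j)))
    , (λ k → coeff (shift (toℕ (opposite k)) (deriv f)) (toℕ (opposite j)))
    ]′ (splitAt (pred n) i)

  -- The first column of sylvester n f is the leading coefficient a of f times
  -- the first column of sylvester n (X^n). Using the latter column instead
  -- performs the division by a in disc f = (-1)^(n(n-1)/2) a⁻¹ Res(f , f′)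
  -- without needing a to be invertible.
  discMatrix : ∀ n → Poly → Matrix (pred n ℕ.+ n)
  discMatrix n f i j =
    if toℕ j ≡ᵇ 0 then sylvester n (shift n 1ₚ) i j else sylvester n f i j

  -- The discriminant of a polynomial of degree n ≥ 1.
  disc : ℕ → Poly → Carrier
  disc n f = (- 1#) ^ ⌊ n ℕ.* pred n /2⌋ * det (pred n ℕ.+ n) (discMatrix n f)

infix 4 _≡_[mod_]
_≡_[mod_] : ℤ → ℤ → ℕ → Set
a ≡ b [mod p ] = + p ℤ.∣ a ℤ.- b

-- ℤ/pℤ as a setoid quotient: the carrier is ℤ and equality is congruence.
ℤ/ : ℕ → CommutativeRing 0ℓ 0ℓ
ℤ/ p = record
  { Carrier = ℤ
  ; _≈_     = _≈_
  ; _+_     = ℤ._+_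
  ; _*_     = ℤ._*_
  ; -_      = ℤ.-_
  ; 0#      = ℤ.0ℤ
  ; 1#      = ℤ.1ℤ
  ; isCommutativeRing = record
    { isRing = record
      { +-isAbelianGroup = record
        { isGroup = record
          { isMonoid = record
            { isSemigroup = record
              { isMagma = record
                { isEquivalence = record
                  { refl  = λ {a} → reflexive {a} refl
                  ; sym   = λ {a} {b} e → subst (+ p ℤ.∣_) (neg-sub a b) (ℤ.∣m⇒∣-m e)
                  ; trans = λ {a} {b} {d} e e′ →
                      subst (+ p ℤ.∣_) (sub-trans a b d) (ℤ.∣m∣n⇒∣m+n e e′)
                  }
                ; ∙-cong = λ {a} {b} {d} {e} h h′ →
                    subst (+ p ℤ.∣_) (sub-+ a b d e) (ℤ.∣m∣n⇒∣m+n h h′)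
                }
              ; assoc = λ a b d → reflexive (ℤ.+-assoc a b d)
              }
            ; identity = (λ a → reflexive (ℤ.+-identityˡ a)) , (λ a → reflexive (ℤ.+-identityʳ a))
            }
          ; inverse = (λ a → reflexive (ℤ.+-inverseˡ a)) , (λ a → reflexive (ℤ.+-inverseʳ a))
          ; ⁻¹-cong = λ {a} {b} h → subst (+ p ℤ.∣_) (sub-neg a b) (ℤ.∣m⇒∣-m h)
          }
        ; comm = λ a b → reflexive (ℤ.+-comm a b)
        }
      ; *-cong = λ {a} {b} {d} {e} h h′ →
          subst (+ p ℤ.∣_) (sub-* a b d e)
            (ℤ.∣m∣n⇒∣m+n (ℤ.∣m⇒∣m*n d h) (ℤ.∣n⇒∣m*n b h′))
      ; *-assoc = λ a b d → reflexive (ℤ.*-assoc a b d)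
      ; *-identity = (λ a → reflexive (ℤ.*-identityˡ a)) , (λ a → reflexive (ℤ.*-identityʳ a))
      ; distrib = (λ a b d → reflexive (ℤ.*-distribˡ-+ a b d))
                , (λ a b d → reflexive (ℤ.*-distribʳ-+ a b d))
      }
    ; *-comm = λ a b → reflexive (ℤ.*-comm a b)
    }
  }
  where
  _≈_ : ℤ → ℤ → Set
  a ≈ b = a ≡ b [mod p ]

  reflexive : ∀ {a b} → a ≡ b → a ≈ b
  reflexive {a} refl = subst (+ p ℤ.∣_) (sym (ℤ.+-inverseʳ a)) (ℤ.divides ℤ.0ℤ refl)

  neg-sub : ∀ a b → ℤ.- (a ℤ.- b) ≡ b ℤ.- a
  neg-sub = solve-∀

  sub-trans : ∀ a b d → (a ℤ.- b) ℤ.+ (b ℤ.- d) ≡ a ℤ.- d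
  sub-trans = solve-∀

  sub-+ : ∀ a b d e → (a ℤ.- b) ℤ.+ (d ℤ.- e) ≡ (a ℤ.+ d) ℤ.- (b ℤ.+ e)
  sub-+ = solve-∀

  sub-neg : ∀ a b → ℤ.- (a ℤ.- b) ≡ (ℤ.- a) ℤ.- (ℤ.- b)
  sub-neg = solve-∀

  sub-* : ∀ a b d e → (a ℤ.- b) ℤ.* d ℤ.+ b ℤ.* (d ℤ.- e) ≡ a ℤ.* d ℤ.- b ℤ.* e
  sub-* = solve-∀

module ℤ[x] = Polynomials ℤ.+-*-commutativeRing
module ℚ[x] = Polynomials ℚ.+-*-commutativeRing
module 𝔽[x] (p : ℕ) = Polynomials (ℤ/ p)

toℚ[x] : ℤ[x].Poly → ℚ[x].Poly
toℚ[x] = map fromℤ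

-- ℤ/ p has carrier ℤ, so reducing the coefficients does not change the list.
reduce : ∀ p → ℤ[x].Poly → 𝔽[x].Poly p
reduce p f = f

SeparableDegree : ℤ[x].Poly → ℕ → Set
SeparableDegree f n = ℚ[x].Separable (toℚ[x] f) × ℤ[x].HasDegree f n

record GoodPrime (f : ℤ[x].Poly) (p : ℕ) : Set where
  field
    prime       : Prime p
    odd         : p ≢ 2
    degree      : ℕ
    degree-f    : ℤ[x].HasDegree f degree
    degree-f̄    : 𝔽[x].HasDegree p (reduce p f) degree
    disc-f̄≢0    : ¬ (𝔽[x].disc p degree (reduce p f) ≡ ℤ.0ℤ [mod p ])

record Squarefree (d : ℤ) : Set where
  field
    nonZero       : ℤ.NonZero d
    square∣⇒unit : ∀ k → k ℤ.* k ℤ.∣ d → k ℤ.∣ ℤ.1ℤ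

-- The graph of r ↦ S(r).
record IsSquarefreePart (r : ℚ) (d : ℤ) : Set where
  field
    squarefree : Squarefree d
  instance
    fromℤ-nonZero : ℚ.NonZero (fromℤ d)
    fromℤ-nonZero = Squarefree.nonZero squarefree
  field
    square     : ∃ λ s → r ℚ.÷ fromℤ d ≡ s ℚ.* s

infix 4 _∈𝒮_
_∈𝒮_ : ℤ → ℤ[x].Poly → Set
d ∈𝒮 f = ∃ λ r → ℚ[x].eval (toℚ[x] f) r ≢ 0ℚ × IsSquarefreePart (ℚ[x].eval (toℚ[x] f) r) d

-- No finite list exhausts P.
InfinitelyMany : {A : Set} → (A → Set) → Set
InfinitelyMany P = ∀ xs → ∃ λ x → x ∉ xs × P x

A : ℕ → Set
A n = ∀ f → SeparableDegree f n →
      ∀ p → GoodPrime f p →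
      ∀ m → ℤ.Coprime m (+ p) →
      InfinitelyMany λ d → d ∈𝒮 f × d ≡ m [mod p ]

P : ℕ → Set
P n = ∀ h → SeparableDegree h n →
      (∃ λ b → ℤ[x].coeff h n ≡ b ℤ.* b) →
      ∀ p → GoodPrime h p →
      ∀ m → ℤ.Coprime m (+ p) →
      InfinitelyMany λ q → Prime q × + q ∈𝒮 h × + q ≡ m [mod p ]

{-# OPTIONS --safe #-}
module Submission where

-- Let a be the leading coefficient of f and write a = A k² with A squarefree.
-- The polynomial a f has square leading coefficient a², is again separable,
-- and every good prime p of f is good for a f, since its discriminant is a
-- power of a times that of f. If a f(r) is q times a square, then
-- f(r) is A q times a square, so S(f(r)) = A q as soon as the prime q does not
-- divide A. It remains to apply P(n) to a f with q ≡ A⁻¹ m (mod p).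

open import Algebra.Bundles using (CommutativeRing; Semiring)
import Algebra.Definitions.RawMonoid as RawMonoidDefs
import Algebra.Definitions.RawSemiring as RawSemiringDefs
import Algebra.Properties.CommutativeSemigroup as CommutativeSemigroupProperties
import Algebra.Properties.Monoid.Sum as SumProperties
import Algebra.Properties.Semiring.Mult as MultProperties
import Algebra.Properties.Semiring.Sum as SemiringSumProperties
open import Data.Bool.Base using (true; false)
open import Data.Fin.Base using (Fin; zero; suc; toℕ; opposite; punchIn; splitAt)
import Data.Integer.Base as ℤ
open ℤ using (ℤ; +_; ∣_∣)
import Data.Integer.Coprimality as ℤ
import Data.Integer.Divisibility.Signed as ℤ
import Data.Integer.Properties as ℤ
open import Data.Integer.Tactic.RingSolver using (solve-∀)
open import Data.List.Base using ([]; _∷_; _++_; map; upTo)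
open import Data.List.Membership.Propositional using (_∈_; _∉_)
open import Data.List.Membership.Propositional.Properties using (∈-map⁺; ∈-++⁺ˡ; ∈-++⁺ʳ; ∈-upTo⁺)
open import Data.List.Properties using (map-∘; map-cong)
open import Data.Nat.Base as ℕ using (ℕ; zero; suc; pred; _≡ᵇ_; _<_)
import Data.Nat.Coprimality as ℕ
import Data.Nat.Divisibility as ℕ
import Data.Nat.DivMod as ℕ
open import Data.Nat.GCD using (module Bézout)
open import Data.Nat.Induction using (Acc; acc; <-wellFounded)
open import Data.Nat.Primality using (Prime; prime⇒irreducible; prime⇒nonTrivial; prime⇒nonZero; euclidsLemma)
import Data.Nat.Properties as ℕ
open import Data.Product.Base using (_×_; _,_; ∃; ∃₂; proj₁)
import Data.Rational.Base as ℚ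
open ℚ using (ℚ; 0ℚ; 1ℚ)
open import Data.Rational.Literals using (fromℤ)
import Data.Rational.Properties as ℚ
open import Data.Rational.Solver using (module +-*-Solver)
import Data.Rational.Unnormalised.Properties as ℚᵘ
open import Data.Sum.Base using (inj₁; inj₂; [_,_]′)
open import Function.Base using (id)
open import Level using (Level)
open import Relation.Binary.Definitions using (tri<; tri≈; tri>)
open import Relation.Binary.PropositionalEquality using (_≡_; _≢_; refl; sym; trans; cong; subst; subst₂; module ≡-Reasoning)
open import Relation.Nullary.Decidable.Core using (yes; no; _×-dec_)
open import Relation.Nullary.Negation.Core using (¬_; contradiction)

open import Defs

-- Multiplying a polynomial by a constant over a commutative ring.

module Scaling {c ℓ : Level} (R : CommutativeRing c ℓ) where
  open CommutativeRing R
    hiding (zero; refl; sym; trans; reflexive)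
  open CommutativeRing R using () renaming (refl to ≈-refl; sym to ≈-sym; trans to ≈-trans)
  open Polynomials R
  open RawMonoidDefs +-rawMonoid using () renaming (_×_ to _·_)
  open RawSemiringDefs (Semiring.rawSemiring semiring) using (_^_)
  open CommutativeSemigroupProperties *-commutativeSemigroup using (x∙yz≈y∙xz; interchange)
  open MultProperties semiring using (×-comm-*)
  open SumProperties +-monoid using (sum-cong-≋)
  open SemiringSumProperties semiring using (*-distribˡ-sum)
  open import Relation.Binary.Reasoning.Setoid setoid

  scale : Carrier → Poly → Poly
  scale a = map (a *_)

  -- A coefficientwise relation up to `≈`, since `shift` and `deriv` do not commute with `scale` as
  -- operations on lists: `0#` and `a * 0#` are only equivalent.
  Multiple : Carrier → Poly → Poly → Set ℓ
  Multiple a g f = ∀ k → coeff g k ≈ a * coeff f k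

  scale-multiple : ∀ a f → Multiple a (scale a f) f
  scale-multiple a []       k       = ≈-sym (zeroʳ a)
  scale-multiple a (b ∷ bs) zero    = ≈-refl
  scale-multiple a (b ∷ bs) (suc k) = scale-multiple a bs k

  shift-multiple : ∀ {a g f} n → Multiple a g f → Multiple a (shift n g) (shift n f)
  shift-multiple     zero    h k       = h k
  shift-multiple {a} (suc n) h zero    = ≈-sym (zeroʳ a)
  shift-multiple     (suc n) h (suc k) = shift-multiple n h k

  -- The local function of deriv has no name outside Defs; the placeholder is
  -- solved to it by the unification problem in deriv-∷∷, whose arguments are
  -- abstracted so that they are distinct variables.
  mutual
    derivFrom : Carrier → Poly → ℕ → Poly → Poly
    derivFrom = _

    deriv-∷∷ : ∀ a b bs → deriv (a ∷ b ∷ bs) ≡ (1 · b) ∷ derivFrom a (b ∷ bs) 2 bs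
    deriv-∷∷ a b bs with b ∷ bs | 2
    ... | _ | _ = refl

  -- The first two arguments of `derivFrom` are the head and tail of the polynomial being
  -- differentiated. They differ between the two sides, so the induction keeps them arbitrary.
  derivFrom-multiple : ∀ a {b b′ as as′} n bs →
                       Multiple a (derivFrom b as n (scale a bs)) (derivFrom b′ as′ n bs)
  derivFrom-multiple a n []       k       = ≈-sym (zeroʳ a)
  derivFrom-multiple a n (b ∷ bs) zero    = ≈-sym (×-comm-* n a b)
  derivFrom-multiple a {b′} {b″} {as} {as′} n (b ∷ bs) (suc k) =
    derivFrom-multiple a {b′} {b″} {as} {as′} (suc n) bs k

  deriv-multiple : ∀ a f → Multiple a (deriv (scale a f)) (deriv f)
  deriv-multiple a []       k = ≈-sym (zeroʳ a)
  deriv-multiple a (b ∷ bs) k =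
    derivFrom-multiple a {a * b} {b} {scale a bs} {bs} 1 bs k

  coeff-+ₚ : ∀ f g k → coeff (f +ₚ g) k ≈ coeff f k + coeff g k
  coeff-+ₚ []       g        k       = ≈-sym (+-identityˡ (coeff g k))
  coeff-+ₚ (a ∷ as) []       k       = ≈-sym (+-identityʳ (coeff (a ∷ as) k))
  coeff-+ₚ (a ∷ as) (b ∷ bs) zero    = ≈-refl
  coeff-+ₚ (a ∷ as) (b ∷ bs) (suc k) = coeff-+ₚ as bs k

  +ₚ-cong : ∀ {f f′ g g′} → f ≈ₚ f′ → g ≈ₚ g′ → f +ₚ g ≈ₚ f′ +ₚ g′
  +ₚ-cong {f} {f′} {g} {g′} e e′ k = begin
    coeff (f +ₚ g) k        ≈⟨ coeff-+ₚ f g k ⟩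
    coeff f k + coeff g k   ≈⟨ +-cong (e k) (e′ k) ⟩
    coeff f′ k + coeff g′ k ≈⟨ coeff-+ₚ f′ g′ k ⟨
    coeff (f′ +ₚ g′) k      ∎

  scale-*ₚ-multiple : ∀ {a b g f} u → b * a ≈ 1# → Multiple a g f → scale b u *ₚ g ≈ₚ u *ₚ f
  scale-*ₚ-multiple {a} {b} {g} {f} []       ba≈1 h k = ≈-refl
  scale-*ₚ-multiple {a} {b} {g} {f} (u ∷ us) ba≈1 h =
    +ₚ-cong {scale (b * u) g} {scale u f} head≈ tail≈
    where
    head≈ : scale (b * u) g ≈ₚ scale u f
    head≈ k = begin
      coeff (scale (b * u) g) k   ≈⟨ scale-multiple (b * u) g k ⟩
      (b * u) * coeff g k         ≈⟨ *-congˡ (h k) ⟩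
      (b * u) * (a * coeff f k)   ≈⟨ interchange b u a (coeff f k) ⟩
      (b * a) * (u * coeff f k)   ≈⟨ *-congʳ ba≈1 ⟩
      1# * (u * coeff f k)        ≈⟨ *-identityˡ _ ⟩
      u * coeff f k               ≈⟨ scale-multiple u f k ⟨
      coeff (scale u f) k         ∎

    tail≈ : (0# ∷ scale b us *ₚ g) ≈ₚ (0# ∷ us *ₚ f)
    tail≈ zero    = ≈-refl
    tail≈ (suc k) = scale-*ₚ-multiple us ba≈1 h k

  -- Multiplying `u` and `v` by the inverse `b` of `a` cancels the factor `a` gained by both `f` and
  -- its derivative, so the Bézout identity is preserved.
  scale-separable : ∀ a b f → b * a ≈ 1# → Separable f → Separable (scale a f)
  scale-separable a b f ba≈1 (u , v , uf+vf′≈1) =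
    scale b u , scale b v , λ k → ≈-trans
      (+ₚ-cong {scale b u *ₚ scale a f} {u *ₚ f}
        (scale-*ₚ-multiple u ba≈1 (scale-multiple a f))
        (scale-*ₚ-multiple v ba≈1 (deriv-multiple a f)) k)
      (uf+vf′≈1 k)

  eval-scale : ∀ a f x → eval (scale a f) x ≈ a * eval f x
  eval-scale a []       x = ≈-sym (zeroʳ a)
  eval-scale a (b ∷ bs) x = begin
    a * b + x * eval (scale a bs) x ≈⟨ +-congˡ (*-congˡ (eval-scale a bs x)) ⟩
    a * b + x * (a * eval bs x)     ≈⟨ +-congˡ (x∙yz≈y∙xz x a _) ⟩
    a * b + a * (x * eval bs x)     ≈⟨ distribˡ a b _ ⟨
    a * (b + x * eval bs x)         ∎

  -- Determinants and the discriminant of a multiple.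

  minor : ∀ {n} → Matrix (suc n) → Fin (suc n) → Matrix n
  minor M i j k = M (punchIn i j) (suc k)

  laplaceTerm : ∀ {n} → Matrix (suc n) → Fin (suc n) → Carrier
  laplaceTerm {n} M i = (- 1#) ^ toℕ i * (M i zero * det n (minor M i))

  -- In the Laplace expansion every term takes one factor `a` from the first column and one factor
  -- `b` from its minor.
  det-multiple : ∀ {n} a b (M M′ : Matrix (suc n)) →
                 (∀ i → M′ i zero ≈ a * M i zero) →
                 (∀ i → det n (minor M′ i) ≈ b * det n (minor M i)) →
                 det (suc n) M′ ≈ (a * b) * det (suc n) M
  det-multiple a b M M′ entry≈ minor≈ =
    ≈-trans (sum-cong-≋ {x = laplaceTerm M′} term≈) (≈-sym (*-distribˡ-sum (a * b) (laplaceTerm M)))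
    where
    term≈ : ∀ i → laplaceTerm M′ i ≈ (a * b) * laplaceTerm M i
    term≈ i = ≈-trans
      (*-congˡ (≈-trans (*-cong (entry≈ i) (minor≈ i)) (interchange a _ b _)))
      (x∙yz≈y∙xz _ (a * b) _)

  det-scale : ∀ a n (M M′ : Matrix n) → (∀ i j → M′ i j ≈ a * M i j) →
              det n M′ ≈ a ^ n * det n M
  det-scale a zero    M M′ h = ≈-sym (*-identityˡ 1#)
  det-scale a (suc n) M M′ h = det-multiple a (a ^ n) M M′
    (λ i → h i zero)
    (λ i → det-scale a n (minor M i) (minor M′ i) λ j k → h (punchIn i j) (suc k))

  -- Only the columns after the first contribute a factor; `pred` also covers the empty matrix. The
  -- Boolean hypotheses match the `if` in `discMatrix`.
  det-scale-but-first : ∀ a n (M M′ : Matrix n) →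
    (∀ i j → (toℕ j ≡ᵇ 0) ≡ true  → M′ i j ≈ M i j) →
    (∀ i j → (toℕ j ≡ᵇ 0) ≡ false → M′ i j ≈ a * M i j) →
    det n M′ ≈ a ^ pred n * det n M
  det-scale-but-first a zero    M M′ first rest = ≈-sym (*-identityˡ 1#)
  det-scale-but-first a (suc n) M M′ first rest = ≈-trans
    (det-multiple 1# (a ^ n) M M′
      (λ i → ≈-trans (first i zero refl) (≈-sym (*-identityˡ _)))
      (λ i → det-scale a n (minor M i) (minor M′ i) λ j k → rest (punchIn i j) (suc k) refl))
    (*-congʳ (*-identityˡ (a ^ n)))

  sylvester-scale : ∀ a n f i j → sylvester n (scale a f) i j ≈ a * sylvester n f i j
  sylvester-scale a n f i j with splitAt (pred n) i
  ... | inj₁ k = shift-multiple (toℕ (opposite k)) (scale-multiple a f) (toℕ (opposite j))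
  ... | inj₂ k = shift-multiple (toℕ (opposite k)) (deriv-multiple a f) (toℕ (opposite j))

  -- The first column of `discMatrix` is that of `X^n` and does not change with `f`; the others are
  -- linear in the coefficients of `f`. For `n ≥ 1` the exponent is `2n - 2`, the degree of
  -- homogeneity of the discriminant.
  disc-scale : ∀ a n f → disc n (scale a f) ≈ a ^ pred (pred n ℕ.+ n) * disc n f
  disc-scale a n f = ≈-trans
    (*-congˡ (det-scale-but-first a (pred n ℕ.+ n) (discMatrix n f) (discMatrix n (scale a f)) first rest))
    (x∙yz≈y∙xz _ _ _)
    where
    first : ∀ i j → (toℕ j ≡ᵇ 0) ≡ true → discMatrix n (scale a f) i j ≈ discMatrix n f i j
    first i j eq rewrite eq = ≈-refl

    rest : ∀ i j → (toℕ j ≡ᵇ 0) ≡ false → discMatrix n (scale a f) i j ≈ a * discMatrix n f i j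
    rest i j eq rewrite eq = sylvester-scale a n f i j

  -- Degree and discriminant under scaling by a non-zero-divisor.

  Regular : Carrier → Set _
  Regular a = ∀ x → a * x ≈ 0# → x ≈ 0#

  ^-regular : ∀ a → Regular a → ∀ n → Regular (a ^ n)
  ^-regular a reg zero    x 1x≈0  = ≈-trans (≈-sym (*-identityˡ x)) 1x≈0
  ^-regular a reg (suc n) x aⁿx≈0 =
    ^-regular a reg n x (reg _ (≈-trans (≈-sym (*-assoc a (a ^ n) x)) aⁿx≈0))

  -- Regularity is the common form of `a ≢ 0` in the integers and of `p ∤ a` in `ℤ/ p`; a good prime
  -- requires the degree in both rings.
  scale-degree : ∀ a f n → Regular a → HasDegree f n → HasDegree (scale a f) n
  scale-degree a f n reg (fₙ≉0 , high) =
    (λ e → fₙ≉0 (reg _ (≈-trans (≈-sym (scale-multiple a f n)) e))) ,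
    (λ k n<k → ≈-trans (scale-multiple a f k) (≈-trans (*-congˡ (high k n<k)) (zeroʳ a)))

  scale-disc≉0 : ∀ a n f → Regular a → ¬ (disc n f ≈ 0#) → ¬ (disc n (scale a f) ≈ 0#)
  scale-disc≉0 a n f reg disc≉0 e =
    disc≉0 (^-regular a reg (pred (pred n ℕ.+ n)) _ (≈-trans (≈-sym (disc-scale a n f)) e))

  degree-unique : ∀ {f m n} → HasDegree f m → HasDegree f n → m ≡ n
  degree-unique {f} {m} {n} (fₘ≉0 , highₘ) (fₙ≉0 , highₙ) with ℕ.<-cmp m n
  ... | tri< m<n _ _ = contradiction (highₘ n m<n) fₙ≉0
  ... | tri≈ _ m≡n _ = m≡n
  ... | tri> _ _ n<m = contradiction (highₙ m n<m) fₘ≉0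

-- Integers, residues modulo `p` and good primes.

module ℤ-Scaling = Scaling ℤ.+-*-commutativeRing
module ℚ-Scaling = Scaling ℚ.+-*-commutativeRing
module 𝔽-Scaling (p : ℕ) = Scaling (ℤ/ p)

≡0⇒∣ : ∀ {p} a → a ≡ ℤ.0ℤ [mod p ] → p ℕ.∣ ∣ a ∣
≡0⇒∣ {p} a e = ℤ.∣⇒∣ᵤ {+ p} {a} (subst (+ _ ℤ.∣_) (ℤ.+-identityʳ a) e)

∣⇒≡0 : ∀ {p} a → p ℕ.∣ ∣ a ∣ → a ≡ ℤ.0ℤ [mod p ]
∣⇒≡0 a e = subst (+ _ ℤ.∣_) (sym (ℤ.+-identityʳ a)) (ℤ.∣ᵤ⇒∣ e)

nonZero⇒≢0 : ∀ a → ℤ.NonZero a → a ≢ ℤ.0ℤ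
nonZero⇒≢0 _ a-nonZero refl = ℕ.≢-nonZero⁻¹ 0 {{a-nonZero}} refl

ℤ-regular : ∀ a → a ≢ ℤ.0ℤ → ℤ-Scaling.Regular a
ℤ-regular a a≢0 x ax≡0 with ℤ.i*j≡0⇒i≡0∨j≡0 a ax≡0
... | inj₁ a≡0 = contradiction a≡0 a≢0
... | inj₂ x≡0 = x≡0

𝔽-regular : ∀ {p} a → Prime p → ¬ (a ≡ ℤ.0ℤ [mod p ]) → 𝔽-Scaling.Regular p a
𝔽-regular {p} a p-prime a≢0 x ax≡0
  with euclidsLemma ∣ a ∣ ∣ x ∣ p-prime (subst (p ℕ.∣_) (ℤ.abs-* a x) (≡0⇒∣ (a ℤ.* x) ax≡0))
... | inj₁ p∣a = contradiction (∣⇒≡0 a p∣a) a≢0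
... | inj₂ p∣x = ∣⇒≡0 x p∣x

-- The two functions `coeff` belong to different instances of `Polynomials`, so they agree by
-- induction on the list and not by computation.
coeff-reduce : ∀ p f k → 𝔽[x].coeff p (reduce p f) k ≡ ℤ[x].coeff f k
coeff-reduce p []       k       = refl
coeff-reduce p (a ∷ as) zero    = refl
coeff-reduce p (a ∷ as) (suc k) = coeff-reduce p as k

scale-goodPrime : ∀ {p} a f → a ≢ ℤ.0ℤ → ¬ (a ≡ ℤ.0ℤ [mod p ]) →
                  GoodPrime f p → GoodPrime (ℤ-Scaling.scale a f) p
scale-goodPrime {p} a f a≢0 a≢0[p] good = record
  { prime    = G.prime
  ; odd      = G.odd
  ; degree   = G.degree
  ; degree-f = ℤ-Scaling.scale-degree a f G.degree (ℤ-regular a a≢0) G.degree-f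
  -- Multiplication in `ℤ/ p` is that of the integers, so reduction commutes with scaling by
  -- definition.
  ; degree-f̄ = 𝔽-Scaling.scale-degree p a f G.degree reg G.degree-f̄
  ; disc-f̄≢0 = 𝔽-Scaling.scale-disc≉0 p a G.degree f reg G.disc-f̄≢0
  }
  where
  module G = GoodPrime good

  reg : 𝔽-Scaling.Regular p a
  reg = 𝔽-regular a G.prime a≢0[p]

-- Scaling over the rationals.

fromℤ-* : ∀ a b → fromℤ (a ℤ.* b) ≡ fromℤ a ℚ.* fromℤ b
-- All denominators are 1, so the unnormalised product is already the image of the integer product.
fromℤ-* a b = ℚ.toℚᵘ-injective (ℚᵘ.≃-sym (ℚ.toℚᵘ-homo-* (fromℤ a) (fromℤ b)))

toℚ[x]-scale : ∀ a f → toℚ[x] (ℤ-Scaling.scale a f) ≡ ℚ-Scaling.scale (fromℤ a) (toℚ[x] f)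
toℚ[x]-scale a f = trans (sym (map-∘ f)) (trans (map-cong (fromℤ-* a) f) (map-∘ f))

scale-separableDegree : ∀ a f n → a ≢ ℤ.0ℤ →
                        SeparableDegree f n → SeparableDegree (ℤ-Scaling.scale a f) n
scale-separableDegree a f n a≢0 (sep , deg) =
  subst ℚ[x].Separable (sym (toℚ[x]-scale a f))
    (ℚ-Scaling.scale-separable (fromℤ a) (ℚ.1/ fromℤ a) (toℚ[x] f) (ℚ.*-inverseˡ (fromℤ a)) sep) ,
  ℤ-Scaling.scale-degree a f n (ℤ-regular a a≢0) deg
  where
  instance
    fromℤ-a-nonZero : ℚ.NonZero (fromℤ a)
    fromℤ-a-nonZero = ℤ.≢-nonZero {a} a≢0

eval-toℚ[x]-scale : ∀ a f r →
  ℚ[x].eval (toℚ[x] (ℤ-Scaling.scale a f)) r ≡ fromℤ a ℚ.* ℚ[x].eval (toℚ[x] f) r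
eval-toℚ[x]-scale a f r =
  trans (cong (λ g → ℚ[x].eval g r) (toℚ[x]-scale a f)) (ℚ-Scaling.eval-scale (fromℤ a) (toℚ[x] f) r)

-- Primes and squarefree integers.

prime∤⇒coprime : ∀ {p n} → Prime p → ¬ (p ℕ.∣ n) → ℕ.Coprime n p
prime∤⇒coprime p-prime p∤n (d∣n , d∣p) with prime⇒irreducible p-prime d∣p
... | inj₁ d≡1  = d≡1
... | inj₂ refl = contradiction d∣n p∤n

prime-coprime⇒∤ : ∀ {p n} → Prime p → ℕ.Coprime n p → ¬ (p ℕ.∣ n)
prime-coprime⇒∤ p-prime coprime p∣n =
  ℕ.nonTrivial⇒≢1 {{prime⇒nonTrivial p-prime}} (coprime (p∣n , ℕ.∣-refl))

prime-∣square : ∀ {p} n → Prime p → p ℕ.∣ n ℕ.* n → p ℕ.∣ n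
prime-∣square n p-prime p∣n² = [ id , id ]′ (euclidsLemma n n p-prime p∣n²)

square∣*prime⇒square∣ : ∀ {q b} k → Prime q → ¬ (q ℕ.∣ b) → k ℕ.* k ℕ.∣ b ℕ.* q → k ℕ.* k ℕ.∣ b
square∣*prime⇒square∣ {q} {b} k q-prime q∤b k²∣bq =
  ℕ.coprime-divisor (prime∤⇒coprime q-prime q∤k²) (subst (k ℕ.* k ℕ.∣_) (ℕ.*-comm b q) k²∣bq)
  where
  q∤k² : ¬ (q ℕ.∣ k ℕ.* k)
  q∤k² q∣k² = q∤b (ℕ.*-cancelʳ-∣ q {{prime⇒nonZero q-prime}}
    (ℕ.∣-trans (ℕ.*-pres-∣ q∣k q∣k) k²∣bq))
    where q∣k = prime-∣square k q-prime q∣k²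

squarefree-*-prime : ∀ A {q} → Squarefree A → Prime q → ¬ (q ℕ.∣ ∣ A ∣) → Squarefree (A ℤ.* + q)
squarefree-*-prime A {q} sf q-prime q∤A = record
  { nonZero      = ℤ.i*j≢0 A (+ q) {{SF.nonZero}} {{prime⇒nonZero q-prime}}
  ; square∣⇒unit = λ k k²∣Aq → SF.square∣⇒unit k
      (ℤ.∣ᵤ⇒∣ (subst (ℕ._∣ ∣ A ∣) (sym (ℤ.abs-* k k))
        (square∣*prime⇒square∣ ∣ k ∣ q-prime q∤A
          (subst₂ ℕ._∣_ (ℤ.abs-* k k) (ℤ.abs-* A (+ q)) (ℤ.∣⇒∣ᵤ k²∣Aq)))))
  }
  where module SF = Squarefree sf

-- It suffices to test the squares j² with 2 ≤ j ≤ ∣a∣.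
squarefree-decomposition : ∀ a → ℤ.NonZero a → ∃₂ λ A k → Squarefree A × a ≡ A ℤ.* (k ℤ.* k)
squarefree-decomposition a a≢0 = go a a≢0 (<-wellFounded ∣ a ∣)
  where
  regroup : ∀ A k j → (A ℤ.* (k ℤ.* k)) ℤ.* (j ℤ.* j) ≡ A ℤ.* ((k ℤ.* j) ℤ.* (k ℤ.* j))
  regroup = solve-∀

  go : ∀ a → ℤ.NonZero a → Acc _<_ ∣ a ∣ → ∃₂ λ A k → Squarefree A × a ≡ A ℤ.* (k ℤ.* k)
  go a a≢0 (acc rec)
    with ℕ.anyUpTo? (λ j → (2 ℕ.≤? j) ×-dec ((+ j ℤ.* + j) ℤ.∣? a)) (suc ∣ a ∣)
  ... | yes (j , _ , 2≤j , ℤ.divides c a≡cj²) =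
    let A , k , sf , c≡Ak² = go c c≢0 (rec ∣c∣<∣a∣)
    in A , k ℤ.* + j , sf ,
       trans a≡cj² (trans (cong (ℤ._* (+ j ℤ.* + j)) c≡Ak²) (regroup A k (+ j)))
    where
    ∣a∣≡ : ∣ a ∣ ≡ ∣ c ∣ ℕ.* (j ℕ.* j)
    ∣a∣≡ = trans (cong ∣_∣ a≡cj²)
      (trans (ℤ.abs-* c _) (cong (∣ c ∣ ℕ.*_) (ℤ.abs-* (+ j) (+ j))))

    c≢0 : ℤ.NonZero c
    c≢0 = ℤ.≢-nonZero {c} λ { refl → nonZero⇒≢0 a a≢0 a≡cj² }

    1<j² : 1 < j ℕ.* j
    1<j² = ℕ.≤-trans (ℕ.s≤s (ℕ.s≤s ℕ.z≤n)) (ℕ.*-mono-≤ 2≤j 2≤j)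

    ∣c∣<∣a∣ : ∣ c ∣ < ∣ a ∣
    ∣c∣<∣a∣ = subst (∣ c ∣ <_) (sym ∣a∣≡) (ℕ.m<m*n ∣ c ∣ (j ℕ.* j) {{c≢0}} 1<j²)
  ... | no none = a , + 1 , record { nonZero = a≢0 ; square∣⇒unit = unit } , sym (ℤ.*-identityʳ a)
    where
    unit : ∀ k → k ℤ.* k ℤ.∣ a → k ℤ.∣ ℤ.1ℤ
    unit k k²∣a = ℤ.∣ᵤ⇒∣ (abs-unit ∣ k ∣ (subst (ℕ._∣ ∣ a ∣) (ℤ.abs-* k k) (ℤ.∣⇒∣ᵤ k²∣a)))
      where
      abs-unit : ∀ j → j ℕ.* j ℕ.∣ ∣ a ∣ → j ℕ.∣ 1
      abs-unit 0 0∣a = contradiction (ℤ.∣i∣≡0⇒i≡0 (ℕ.0∣⇒≡0 0∣a)) (nonZero⇒≢0 a a≢0)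
      abs-unit 1 _   = ℕ.∣-refl
      -- Here `j ≤ j * j ≤ ∣ a ∣`, so `j` lies in the searched range below `suc ∣ a ∣`.
      abs-unit j@(suc (suc _)) j²∣a = contradiction
        (j , ℕ.s≤s (ℕ.≤-trans (ℕ.m≤m*n j j) (ℕ.∣⇒≤ {{a≢0}} j²∣a)) , ℕ.s≤s (ℕ.s≤s ℕ.z≤n)
           , ℤ.∣ᵤ⇒∣ (subst (ℕ._∣ ∣ a ∣) (sym (ℤ.abs-* (+ j) (+ j))) j²∣a))
        none

-- Division modulo `p`.

inverse-mod : ∀ {p} a → ℕ.Coprime ∣ a ∣ p → ∃ λ x → a ℤ.* x ≡ ℤ.1ℤ [mod p ]
inverse-mod {p} a coprime with ℤ.m∣∣m∣ {a} | ℕ.coprime-Bézout coprime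
-- The relation `∣ a ∣ = s a` carries the Bézout identity from `∣ a ∣` to `a`. Natural-number Bézout
-- has two cases, according to the side on which the 1 stands; the second yields the negated
-- inverse.
... | ℤ.divides s ∣a∣≡sa | Bézout.+- x y 1+yp≡xa = + x ℤ.* s , ℤ.divides (+ y) (begin
  a ℤ.* (+ x ℤ.* s) ℤ.- ℤ.1ℤ          ≡⟨ regroup a (+ x) s ⟩
  + x ℤ.* (s ℤ.* a) ℤ.- ℤ.1ℤ          ≡⟨ cong (λ z → + x ℤ.* z ℤ.- ℤ.1ℤ) ∣a∣≡sa ⟨
  + x ℤ.* + ∣ a ∣ ℤ.- ℤ.1ℤ            ≡⟨ cong (ℤ._- ℤ.1ℤ) (ℤ.pos-* x ∣ a ∣) ⟨
  + (x ℕ.* ∣ a ∣) ℤ.- ℤ.1ℤ            ≡⟨ cong (λ z → + z ℤ.- ℤ.1ℤ) 1+yp≡xa ⟨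
  ℤ.1ℤ ℤ.+ + (y ℕ.* p) ℤ.- ℤ.1ℤ       ≡⟨ cancel (+ (y ℕ.* p)) ⟩
  + (y ℕ.* p)                         ≡⟨ ℤ.pos-* y p ⟩
  + y ℤ.* + p                         ∎)
  where
  open ≡-Reasoning
  regroup : ∀ a x s → a ℤ.* (x ℤ.* s) ℤ.- ℤ.1ℤ ≡ x ℤ.* (s ℤ.* a) ℤ.- ℤ.1ℤ
  regroup = solve-∀
  cancel : ∀ z → ℤ.1ℤ ℤ.+ z ℤ.- ℤ.1ℤ ≡ z
  cancel = solve-∀
... | ℤ.divides s ∣a∣≡sa | Bézout.-+ x y 1+xa≡yp = ℤ.- (+ x ℤ.* s) , ℤ.divides (ℤ.- + y) (begin
  a ℤ.* (ℤ.- (+ x ℤ.* s)) ℤ.- ℤ.1ℤ    ≡⟨ regroup a (+ x) s ⟩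
  ℤ.- (ℤ.1ℤ ℤ.+ + x ℤ.* (s ℤ.* a))    ≡⟨ cong (λ z → ℤ.- (ℤ.1ℤ ℤ.+ + x ℤ.* z)) ∣a∣≡sa ⟨
  ℤ.- (ℤ.1ℤ ℤ.+ + x ℤ.* + ∣ a ∣)      ≡⟨ cong (λ z → ℤ.- (ℤ.1ℤ ℤ.+ z)) (ℤ.pos-* x ∣ a ∣) ⟨
  ℤ.- (+ (1 ℕ.+ x ℕ.* ∣ a ∣))         ≡⟨ cong (λ z → ℤ.- (+ z)) 1+xa≡yp ⟩
  ℤ.- (+ (y ℕ.* p))                   ≡⟨ cong ℤ.-_ (ℤ.pos-* y p) ⟩
  ℤ.- (+ y ℤ.* + p)                   ≡⟨ ℤ.neg-distribˡ-* (+ y) (+ p) ⟩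
  (ℤ.- + y) ℤ.* + p                   ∎)
  where
  open ≡-Reasoning
  regroup : ∀ a x s → a ℤ.* (ℤ.- (x ℤ.* s)) ℤ.- ℤ.1ℤ ≡ ℤ.- (ℤ.1ℤ ℤ.+ x ℤ.* (s ℤ.* a))
  regroup = solve-∀

-- Supplies the residue class to which P(n) is applied, which must be coprime to `p`: as
-- `m = a x - (a x - m)`, a prime `p` dividing `x` would divide `m`.
quotient-mod : ∀ {p} → Prime p → ∀ a m → ℤ.Coprime a (+ p) → ℤ.Coprime m (+ p) →
               ∃ λ x → ℤ.Coprime x (+ p) × a ℤ.* x ≡ m [mod p ]
quotient-mod {p} p-prime a m a-coprime m-coprime with inverse-mod a a-coprime
... | y , ay≡1 = x , prime∤⇒coprime p-prime p∤x , ax≡m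
  where
  x = y ℤ.* m

  distribute : ∀ a y m → (a ℤ.* y ℤ.- ℤ.1ℤ) ℤ.* m ≡ a ℤ.* (y ℤ.* m) ℤ.- m
  distribute = solve-∀

  ax≡m : a ℤ.* x ≡ m [mod p ]
  ax≡m = subst (+ p ℤ.∣_) (distribute a y m) (ℤ.∣m⇒∣m*n m ay≡1)

  recover : ∀ u m → u ℤ.- (u ℤ.- m) ≡ m
  recover = solve-∀

  p∤x : ¬ (p ℕ.∣ ∣ x ∣)
  p∤x p∣x = prime-coprime⇒∤ p-prime m-coprime (ℤ.∣⇒∣ᵤ (subst (+ p ℤ.∣_) (recover (a ℤ.* x) m)
    (ℤ.∣m∣n⇒∣m-n (ℤ.∣n⇒∣m*n a (ℤ.∣ᵤ⇒∣ p∣x)) ax≡m)))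

-- Squarefree parts after removing a constant factor.

÷⇒* : ∀ r x {t} .{{_ : ℚ.NonZero x}} → r ℚ.÷ x ≡ t → r ≡ t ℚ.* x
÷⇒* r x refl = sym (trans (ℚ.*-assoc r (ℚ.1/ x) x)
  (trans (cong (r ℚ.*_) (ℚ.*-inverseˡ x)) (ℚ.*-identityʳ r)))

*⇒÷ : ∀ t x {r} .{{_ : ℚ.NonZero x}} → r ≡ t ℚ.* x → r ℚ.÷ x ≡ t
*⇒÷ t x refl = trans (ℚ.*-assoc t x (ℚ.1/ x))
  (trans (cong (t ℚ.*_) (ℚ.*-inverseʳ x)) (ℚ.*-identityʳ t))

-- Dividing by `a = A k²` and writing `1/A` as `A/A²` turns `s² q / a` into `(s / (A k))² A q`; `t`
-- stands for `1 / (A k)`.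
square-unscale : ∀ {a A k q r s t : ℚ} → t ℚ.* (A ℚ.* k) ≡ 1ℚ → a ≡ A ℚ.* (k ℚ.* k) →
                 a ℚ.* r ≡ (s ℚ.* s) ℚ.* q → r ≡ ((s ℚ.* t) ℚ.* (s ℚ.* t)) ℚ.* (A ℚ.* q)
square-unscale {a} {A} {k} {q} {r} {s} {t} tAk≡1 a≡Ak² ar≡s²q = begin
  r                                                ≡⟨ ℚ.*-identityˡ r ⟨
  1ℚ ℚ.* r                                         ≡⟨ ℚ.*-identityˡ (1ℚ ℚ.* r) ⟨
  -- Two units are needed because `(t A k)²` splits as `t² A` times `A k²`, which exposes the factor
  -- `a`.
  1ℚ ℚ.* (1ℚ ℚ.* r)                                ≡⟨ cong (λ z → z ℚ.* (z ℚ.* r)) tAk≡1 ⟨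
  (t ℚ.* (A ℚ.* k)) ℚ.* ((t ℚ.* (A ℚ.* k)) ℚ.* r)  ≡⟨ regroup₁ ⟩
  (t ℚ.* t ℚ.* A) ℚ.* ((A ℚ.* (k ℚ.* k)) ℚ.* r)    ≡⟨ cong (λ z → (t ℚ.* t ℚ.* A) ℚ.* (z ℚ.* r)) a≡Ak² ⟨
  (t ℚ.* t ℚ.* A) ℚ.* (a ℚ.* r)                    ≡⟨ cong ((t ℚ.* t ℚ.* A) ℚ.*_) ar≡s²q ⟩
  (t ℚ.* t ℚ.* A) ℚ.* ((s ℚ.* s) ℚ.* q)            ≡⟨ regroup₂ ⟩
  ((s ℚ.* t) ℚ.* (s ℚ.* t)) ℚ.* (A ℚ.* q)          ∎
  where
  open ≡-Reasoning
  open +-*-Solver using (solve; _:*_; _:=_)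

  regroup₁ : (t ℚ.* (A ℚ.* k)) ℚ.* ((t ℚ.* (A ℚ.* k)) ℚ.* r) ≡
             (t ℚ.* t ℚ.* A) ℚ.* ((A ℚ.* (k ℚ.* k)) ℚ.* r)
  regroup₁ = solve 4 (λ t A k r → (t :* (A :* k)) :* ((t :* (A :* k)) :* r)
                               := (t :* t :* A) :* ((A :* (k :* k)) :* r)) refl t A k r

  regroup₂ : (t ℚ.* t ℚ.* A) ℚ.* ((s ℚ.* s) ℚ.* q) ≡ ((s ℚ.* t) ℚ.* (s ℚ.* t)) ℚ.* (A ℚ.* q)
  regroup₂ = solve 4 (λ s t A q → (t :* t :* A) :* ((s :* s) :* q)
                               := ((s :* t) :* (s :* t)) :* (A :* q)) refl s t A q

squarefreePart-unscale : ∀ a A k q {r} → ℤ.NonZero a → a ≡ A ℤ.* (k ℤ.* k) →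
  Squarefree (A ℤ.* q) → IsSquarefreePart (fromℤ a ℚ.* r) q → IsSquarefreePart r (A ℤ.* q)
squarefreePart-unscale a A k q {r} a≢0 a≡Ak² sf part with IsSquarefreePart.square part
... | s , ar/q≡s² = record
  { squarefree = sf
  ; square     = s ℚ.* t , *⇒÷ ((s ℚ.* t) ℚ.* (s ℚ.* t)) (fromℤ (A ℤ.* q)) {{Squarefree.nonZero sf}} r≡
  }
  where
  instance
    q-nonZero : ℚ.NonZero (fromℤ q)
    q-nonZero = IsSquarefreePart.fromℤ-nonZero part

    Ak-nonZero : ℚ.NonZero (fromℤ (A ℤ.* k))
    Ak-nonZero = ℤ.≢-nonZero {A ℤ.* k} λ Ak≡0 → nonZero⇒≢0 a a≢0
      (trans a≡Ak² (trans (sym (ℤ.*-assoc A k k)) (cong (ℤ._* k) Ak≡0)))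

  t : ℚ
  t = ℚ.1/ fromℤ (A ℤ.* k)

  tAk≡1 : t ℚ.* (fromℤ A ℚ.* fromℤ k) ≡ 1ℚ
  tAk≡1 = trans (cong (t ℚ.*_) (sym (fromℤ-* A k))) (ℚ.*-inverseˡ (fromℤ (A ℤ.* k)))

  a≡ : fromℤ a ≡ fromℤ A ℚ.* (fromℤ k ℚ.* fromℤ k)
  a≡ = trans (cong fromℤ a≡Ak²)
    (trans (fromℤ-* A (k ℤ.* k)) (cong (fromℤ A ℚ.*_) (fromℤ-* k k)))

  r≡ : r ≡ ((s ℚ.* t) ℚ.* (s ℚ.* t)) ℚ.* fromℤ (A ℤ.* q)
  r≡ = trans
    (square-unscale {fromℤ a} {fromℤ A} {fromℤ k} {fromℤ q} {r} {s} {t} tAk≡1 a≡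
      (÷⇒* (fromℤ a ℚ.* r) (fromℤ q) ar/q≡s²))
    (cong (((s ℚ.* t) ℚ.* (s ℚ.* t)) ℚ.*_) (sym (fromℤ-* A q)))

-- The same argument `r` serves for both polynomials, since their values there differ by the factor
-- `a`.
∈𝒮-unscale : ∀ a A k {q} f → ℤ.NonZero a → a ≡ A ℤ.* (k ℤ.* k) →
             Squarefree A → Prime q → ¬ (q ℕ.∣ ∣ A ∣) →
             + q ∈𝒮 ℤ-Scaling.scale a f → A ℤ.* + q ∈𝒮 f
∈𝒮-unscale a A k {q} f a-nonZero a≡Ak² A-sf q-prime q∤A (r , hr≢0 , hr-part) =
  r , fr≢0 ,
  squarefreePart-unscale a A k (+ q) a-nonZero a≡Ak² (squarefree-*-prime A A-sf q-prime q∤A)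
    (subst (λ z → IsSquarefreePart z (+ q)) (eval-toℚ[x]-scale a f r) hr-part)
  where
  fr≢0 : ℚ[x].eval (toℚ[x] f) r ≢ 0ℚ
  fr≢0 fr≡0 = hr≢0 (trans (eval-toℚ[x]-scale a f r)
    (trans (cong (fromℤ a ℚ.*_) fr≡0) (ℚ.*-zeroʳ (fromℤ a))))

-- Infinitude of the values `A q`.

-- Only finitely many q divide A or satisfy A q ∈ xs.
infinitelyMany-multiples : ∀ {Q : ℕ → Set} {T : ℤ → Set} A → ℤ.NonZero A →
  (∀ q → ¬ (q ℕ.∣ ∣ A ∣) → Q q → T (A ℤ.* + q)) → InfinitelyMany Q → InfinitelyMany T
infinitelyMany-multiples {Q} {T} A A≢0 Q⇒T inf xs = multiple (inf excluded)
  where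
  instance
    A-nonZero : ℕ.NonZero ∣ A ∣
    A-nonZero = A≢0

  -- Dividing absolute values by `∣ A ∣` recovers `q` from an entry `A q` of `xs`. A divisor of `A`
  -- is at most `∣ A ∣`, and `upTo` excludes its bound, hence the `suc`.
  quotients = map (λ d → ∣ d ∣ ℕ./ ∣ A ∣) xs
  excluded  = quotients ++ upTo (suc ∣ A ∣)

  Aq/A≡q : ∀ q → ∣ A ℤ.* + q ∣ ℕ./ ∣ A ∣ ≡ q
  Aq/A≡q q = trans (cong (ℕ._/ ∣ A ∣) (trans (ℤ.abs-* A (+ q)) (ℕ.*-comm ∣ A ∣ q)))
    (ℕ.m*n/n≡m q ∣ A ∣)

  multiple : (∃ λ q → q ∉ excluded × Q q) → ∃ λ d → d ∉ xs × T d
  multiple (q , q∉ , Qq) =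
    A ℤ.* + q ,
    (λ Aq∈xs → q∉ (∈-++⁺ˡ (subst (_∈ quotients) (Aq/A≡q q) (∈-map⁺ _ Aq∈xs)))) ,
    Q⇒T q (λ q∣A → q∉ (∈-++⁺ʳ quotients (∈-upTo⁺ (ℕ.s≤s (ℕ.∣⇒≤ q∣A))))) Qq

-- Deduction of A(n) from P(n).

lemma3p2 : (n : ℕ) → 0 < n → P n → A n
lemma3p2 n _ Pn f sep@(_ , deg) p good m m-coprime = scaled (squarefree-decomposition a a-nonZero)
  where
  module G = GoodPrime good
  module ℤ/p = CommutativeRing (ℤ/ p)

  a : ℤ
  a = ℤ[x].coeff f n

  a≢0 : a ≢ ℤ.0ℤ
  a≢0 = proj₁ deg

  a-nonZero : ℤ.NonZero a
  a-nonZero = ℤ.≢-nonZero {a} a≢0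

  a≢0[p] : ¬ (a ≡ ℤ.0ℤ [mod p ])
  -- A good prime carries its own degree, which uniqueness identifies with `n`; the reduced leading
  -- coefficient is then `a` modulo `p`.
  a≢0[p] = subst (λ z → ¬ (z ≡ ℤ.0ℤ [mod p ]))
    (trans (coeff-reduce p f G.degree) (cong (ℤ[x].coeff f) (ℤ-Scaling.degree-unique {f} G.degree-f deg)))
    (proj₁ G.degree-f̄)

  Target : ℤ → Set
  Target d = d ∈𝒮 f × d ≡ m [mod p ]

  scaled : (∃₂ λ A k → Squarefree A × a ≡ A ℤ.* (k ℤ.* k)) → InfinitelyMany Target
  scaled (A , k , A-sf , a≡Ak²) =
    congruent (quotient-mod G.prime A m (prime∤⇒coprime G.prime p∤A) m-coprime)
    where
    p∤A : ¬ (p ℕ.∣ ∣ A ∣)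
    p∤A p∣A = a≢0[p] (∣⇒≡0 a (subst (λ z → p ℕ.∣ ∣ z ∣) (sym a≡Ak²)
      (ℤ.∣⇒∣ᵤ (ℤ.∣m⇒∣m*n {+ p} {A} (k ℤ.* k) (ℤ.∣ᵤ⇒∣ p∣A)))))

    congruent : (∃ λ m′ → ℤ.Coprime m′ (+ p) × A ℤ.* m′ ≡ m [mod p ]) → InfinitelyMany Target
    congruent (m′ , m′-coprime , Am′≡m) =
      infinitelyMany-multiples {T = Target} A (Squarefree.nonZero A-sf)
        (λ q q∤A (q-prime , q∈𝒮 , q≡m′) →
          ∈𝒮-unscale a A k f a-nonZero a≡Ak² A-sf q-prime q∤A q∈𝒮 ,
          ℤ/p.trans {A ℤ.* + q} {A ℤ.* m′} {m}
            (ℤ/p.*-cong {A} {A} {+ q} {m′} (ℤ/p.refl {A}) q≡m′) Am′≡m)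
        (Pn (ℤ-Scaling.scale a f) (scale-separableDegree a f n a≢0 sep)
          -- The leading coefficient of `a f` is `a` times that of `f`, hence the square of `a`.
          (a , ℤ-Scaling.scale-multiple a f n)
          p (scale-goodPrime a f a≢0 a≢0[p] good) m′ m′-coprime)
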